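{- Let $\mathbf P=\{\mathbf p_1,\mathbf p_2,\mathbf p_3,\mathbf p_4\}\subseteq\mathbb{Q}^2$ be a set of four non-zero vectors, not all parallel and no two equal or opposite. Then $\mathbf P$ satisfies the Lonely Vector Property.
   Context: For $\mathbf P=\{\mathbf p_1,\dots,\mathbf p_n\}\subseteq\mathbb{R}^2$ let $S_{\mathbf P}$ be the multiset of cardinality $n^2$ given by $$S_{\mathbf P}=\mathbf P\cup\{\mathbf p_i+\mathbf p_j:1\le i<j\le n\}\cup\{\mathbf p_i-\mathbf p_j:1\le i<j\le n\}.$$ $\mathbf P$ satisfies the Lonely Vector Property (LVP) if $S_{\mathbf P}$ contains a vector that is not parallel to any other vector in the multiset $S_{\mathbf P}$. -}

module Defs where

open import Data.Fin using (Fin; _<?_)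
open import Data.List using (List; _++_; map; filter; length; lookup; allFin; cartesianProduct)
open import Data.Nat using (ℕ)
open import Data.Product using (_×_; _,_; ∃; proj₁; proj₂)
open import Data.Rational using (ℚ; 0ℚ; _+_; _*_; -_)
open import Data.Sum using (_⊎_)
open import Relation.Binary.PropositionalEquality using (_≡_; _≢_)
open import Relation.Nullary using (¬_)

ℚ² : Set
ℚ² = ℚ × ℚ

infixl 6 _+ᵥ_ _-ᵥ_
infixl 7 _*ᵥ_
infix  8 -ᵥ_

0ᵥ : ℚ²
0ᵥ = 0ℚ , 0ℚ

_+ᵥ_ : ℚ² → ℚ² → ℚ²
(a , b) +ᵥ (c , d) = a + c , b + d

-ᵥ_ : ℚ² → ℚ²
-ᵥ (a , b) = - a , - b

_-ᵥ_ : ℚ² → ℚ² → ℚ²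
u -ᵥ v = u +ᵥ -ᵥ v

_*ᵥ_ : ℚ → ℚ² → ℚ²
t *ᵥ (a , b) = t * a , t * b

-- One vector is a scalar multiple of the other, so the zero vector is
-- parallel to everything.  For vectors in ℚ², rational and real scalars give
-- the same relation.
Parallel : ℚ² → ℚ² → Set
Parallel u v = (∃ λ t → u ≡ t *ᵥ v) ⊎ (∃ λ t → v ≡ t *ᵥ u)

-- The pairs (i , j) with i < j.
pairs : ∀ n → List (Fin n × Fin n)
pairs n = filter (λ ij → proj₁ ij <? proj₂ ij) (cartesianProduct (allFin n) (allFin n))

-- The multiset S_P, as a list; its n² entries are kept with multiplicity.
S : ∀ {n} → (Fin n → ℚ²) → List ℚ²
S {n} p = map p (allFin n)
       ++ map (λ ij → p (proj₁ ij) +ᵥ p (proj₂ ij)) (pairs n)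
       ++ map (λ ij → p (proj₁ ij) -ᵥ p (proj₂ ij)) (pairs n)

-- Entries are compared by position, not by value: an equal vector occurring
-- at a different position counts as another vector of the multiset.
LonelyVectorProperty : ∀ {n} → (Fin n → ℚ²) → Set
LonelyVectorProperty p =
  ∃ λ (k : Fin (length (S p))) →
    ∀ l → l ≢ k → ¬ Parallel (lookup (S p) k) (lookup (S p) l)

{-# OPTIONS --safe #-}

-- Let d be the vector of the six determinants det(pᵢ, pⱼ), i < j.  The entries
-- of S p are integer combinations of the pᵢ, so two of them are parallel exactly
-- when a certain integer linear form vanishes at d.  If no entry is lonely, each
-- of the 16 entries yields such an equation for d, chosen among nine.  A depth-first
-- search over these choices maintains an integer basis of the space of possible d.
-- A branch ends when some entry of S p is forced to vanish, which is only possible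
-- for d = 0, or when a single vector off the Plücker quadric is left.  When all 16
-- entries are served, a pencil is left.  Its intersection with the quadric consists
-- either of two rational points that are excluded in the same way, or of two points
-- conjugate over ℚ(√2) or ℚ(i); this is where rationality of the pᵢ enters.  So d = 0
-- and all the pᵢ are parallel.

module Submission where

open import Algebra.Properties.Group using (inverseˡ-unique; x∙y⁻¹≈ε⇒x≈y)
open import Data.Bool using (Bool; true; if_then_else_; _∨_; T)
open import Data.Bool.ListAction using (all)
open import Data.Bool.Properties using (T-∨; T-≡)
open import Data.Empty using (⊥)
open import Data.Fin as Fin using (Fin; zero; suc; toℕ)
open import Data.Fin.Patterns using (0F; 1F; 2F; 3F)
import Data.Fin.Properties as Fin
open import Data.Integer as ℤ using (ℤ; +_; -[1+_]; 0ℤ; 1ℤ)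
import Data.Integer.Properties as ℤ
open import Data.List using (List; []; _∷_; _++_; map; filter; deduplicate; lookup; length; allFin)
open import Data.List.Membership.Propositional using (lose)
open import Data.List.Membership.Propositional.Properties using (∈-filter⁺; ∈-allFin)
open import Data.List.Relation.Unary.All as All using (All; []; _∷_)
import Data.List.Relation.Unary.All.Properties as All
open import Data.List.Relation.Unary.Any as Any using (Any; here; there)
import Data.List.Relation.Unary.Any.Properties as Any
open import Data.Nat as ℕ using (zero; suc)
open import Data.Nat.Divisibility using (_∣_; divides; m∣m*n)
open import Data.Nat.Induction using (<-rec)
open import Data.Nat.Primality using (euclidsLemma; prime[2])
import Data.Nat.Properties as ℕ
import Data.Nat.Solver as ℕ
open import Data.Product using (_×_; _,_; ∃; proj₁; proj₂; swap; uncurry; map₂)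
open import Data.Rational using (ℚ; 0ℚ; 1ℚ; _+_; _*_; -_; _-_; ↥_; ↧_; 1/_; ≢-nonZero)
open import Data.Rational.Literals using (fromℤ)
open import Data.Rational.Properties
open import Data.Rational.Solver using (module +-*-Solver)
import Data.Rational.Unnormalised as ℚᵘ
import Data.Rational.Unnormalised.Properties as ℚᵘ
open import Data.Sum as Sum using (_⊎_; inj₁; inj₂; [_,_]′; reduce)
open import Data.Unit using (⊤)
open import Data.Vec as Vec using (Vec; []; _∷_)
import Data.Vec.Properties as Vec
open import Function using (_∘_; Equivalence)
open import Relation.Binary.PropositionalEquality
open import Relation.Nullary using (¬_; Dec; yes; no; ¬?; contradiction)
open import Relation.Nullary.Decidable using (_×-dec_; _⊎-dec_; _→-dec_; ⌊_⌋; toWitness; decidable-stable)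
open import Defs

open +-*-Solver
open ≡-Reasoning

-- Rational arithmetic

fromℤ-homo-+ : ∀ m n → fromℤ (m ℤ.+ n) ≡ fromℤ m + fromℤ n
fromℤ-homo-+ m n = toℚᵘ-injective (ℚᵘ.≃-trans
  (ℚᵘ.*≡* (cong (ℤ._* 1ℤ) (sym (cong₂ ℤ._+_ (ℤ.*-identityʳ m) (ℤ.*-identityʳ n)))))
  (ℚᵘ.≃-sym (toℚᵘ-homo-+ (fromℤ m) (fromℤ n))))

fromℤ-homo-* : ∀ m n → fromℤ (m ℤ.* n) ≡ fromℤ m * fromℤ n
fromℤ-homo-* m n = toℚᵘ-injective (ℚᵘ.≃-trans
  (ℚᵘ.*≡* refl) (ℚᵘ.≃-sym (toℚᵘ-homo-* (fromℤ m) (fromℤ n))))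

fromℤ-homo-neg : ∀ m → fromℤ (ℤ.- m) ≡ - fromℤ m
fromℤ-homo-neg (+ 0) = refl
fromℤ-homo-neg ℤ.+[1+ _ ] = refl
fromℤ-homo-neg -[1+ _ ] = refl

fromℤ-homo-- : ∀ m n → fromℤ (m ℤ.- n) ≡ fromℤ m - fromℤ n
fromℤ-homo-- m n = trans (fromℤ-homo-+ m (ℤ.- n)) (cong (λ q → fromℤ m + q) (fromℤ-homo-neg n))

fromℤ-minor : ∀ a b c d → fromℤ (a ℤ.* b ℤ.- c ℤ.* d) ≡ fromℤ a * fromℤ b - fromℤ c * fromℤ d
fromℤ-minor a b c d = trans (fromℤ-homo-- (a ℤ.* b) (c ℤ.* d))
  (cong₂ (λ p q → p - q) (fromℤ-homo-* a b) (fromℤ-homo-* c d))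

fromℤ-injective : ∀ {m n} → fromℤ m ≡ fromℤ n → m ≡ n
fromℤ-injective = cong ↥_

fromℤ-≢0 : ∀ {z} → z ≢ 0ℤ → fromℤ z ≢ 0ℚ
fromℤ-≢0 z≢0 = z≢0 ∘ fromℤ-injective

q*↧q≡↥q : ∀ q → q * fromℤ (↧ q) ≡ fromℤ (↥ q)
q*↧q≡↥q q@record{} = toℚᵘ-injective (ℚᵘ.≃-trans (toℚᵘ-homo-* q (fromℤ (↧ q)))
  (ℚᵘ.*≡* (trans (ℤ.*-identityʳ _) (cong (λ d → ↥ q ℤ.* + d) (sym (ℕ.*-identityʳ _))))))

inverse : ∀ {q} → q ≢ 0ℚ → ∃ λ k → k * q ≡ 1ℚ
inverse {q} q≢0 = 1/ q , *-inverseˡ q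
  where instance _ = ≢-nonZero q≢0

p*q≡0⇒q≡0 : ∀ {p q} → p ≢ 0ℚ → p * q ≡ 0ℚ → q ≡ 0ℚ
p*q≡0⇒q≡0 {p} {q} p≢0 pq≡0 with k , kp≡1 ← inverse p≢0 = begin
  q           ≡⟨ *-identityˡ q ⟨
  1ℚ * q      ≡⟨ cong (_* q) kp≡1 ⟨
  k * p * q   ≡⟨ *-assoc k p q ⟩
  k * (p * q) ≡⟨ cong (k *_) pq≡0 ⟩
  k * 0ℚ      ≡⟨ *-zeroʳ k ⟩
  0ℚ          ∎

p*q≡0⇒p≡0∨q≡0 : ∀ p {q} → p * q ≡ 0ℚ → p ≡ 0ℚ ⊎ q ≡ 0ℚ
p*q≡0⇒p≡0∨q≡0 p pq≡0 with p ≟ 0ℚ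
... | yes p≡0 = inj₁ p≡0
... | no p≢0 = inj₂ (p*q≡0⇒q≡0 p≢0 pq≡0)

proportional-≢0 : ∀ a b c d → a ≢ 0ℚ → a * d - b * c ≡ 0ℚ → ∃ λ t → c ≡ t * a × d ≡ t * b
proportional-≢0 a b c d a≢0 ad≡bc with k , ka≡1 ← inverse a≢0 = k * c , sym kca≡c , sym kcb≡d
  where
  kca≡c : k * c * a ≡ c
  kca≡c = begin
    k * c * a ≡⟨ solve 3 (λ k a c → k :* c :* a := k :* a :* c) refl k a c ⟩
    k * a * c ≡⟨ cong (_* c) ka≡1 ⟩
    1ℚ * c    ≡⟨ *-identityˡ c ⟩
    c         ∎
  kcb≡d : k * c * b ≡ d
  kcb≡d = begin
    k * c * b                       ≡⟨ solve 5 (λ k a b c d → k :* c :* b := k :* a :* d :- k :* (a :* d :- b :* c)) refl k a b c d ⟩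
    k * a * d - k * (a * d - b * c) ≡⟨ cong₂ (λ p q → p * d - k * q) ka≡1 ad≡bc ⟩
    1ℚ * d - k * 0ℚ                 ≡⟨ solve 2 (λ k d → con 1ℚ :* d :- k :* con 0ℚ := d) refl k d ⟩
    d                               ∎

proportional : ∀ a b c d → a ≢ 0ℚ ⊎ b ≢ 0ℚ → a * d - b * c ≡ 0ℚ → ∃ λ t → c ≡ t * a × d ≡ t * b
proportional a b c d (inj₁ a≢0) ad≡bc = proportional-≢0 a b c d a≢0 ad≡bc
proportional a b c d (inj₂ b≢0) ad≡bc = map₂ swap (proportional-≢0 b a d c b≢0 (trans
  (solve 4 (λ a b c d → b :* c :- a :* d := :- (a :* d :- b :* c)) refl a b c d) (cong -_ ad≡bc)))

-- Infinite descent: a solution (m , n) with m ≠ 0 yields the smaller solution (n , m / 2).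
m²≡2n²⇒m≡0 : ∀ m n → m ℕ.* m ≡ 2 ℕ.* (n ℕ.* n) → m ≡ 0
m²≡2n²⇒m≡0 = <-rec (λ m → ∀ n → m ℕ.* m ≡ 2 ℕ.* (n ℕ.* n) → m ≡ 0) descend
  where
  descend : ∀ m → (∀ {k} → k ℕ.< m → ∀ n → k ℕ.* k ≡ 2 ℕ.* (n ℕ.* n) → k ≡ 0) →
            ∀ n → m ℕ.* m ≡ 2 ℕ.* (n ℕ.* n) → m ≡ 0
  descend zero _ _ _ = refl
  descend m@(suc _) rec n eq
    -- The prime 2 divides `m * m`, hence `m`. Both alternatives of Euclid's lemma are this same
    -- divisibility, so `reduce` merges them.
    with divides k m≡k2 ← reduce (euclidsLemma m m prime[2] (subst (2 ∣_) (sym eq) (m∣m*n (n ℕ.* n)))) =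
    contradiction (rec n<m k n²≡2k²) n≢0
    where
    n²≡2k² : n ℕ.* n ≡ 2 ℕ.* (k ℕ.* k)
    n²≡2k² = ℕ.*-cancelˡ-≡ _ _ 2 (begin
      2 ℕ.* (n ℕ.* n)         ≡⟨ eq ⟨
      m ℕ.* m                 ≡⟨ cong (λ x → x ℕ.* x) m≡k2 ⟩
      k ℕ.* 2 ℕ.* (k ℕ.* 2)   ≡⟨ ℕS.solve 1 (λ k → k ℕS.:* ℕS.con 2 ℕS.:* (k ℕS.:* ℕS.con 2) ℕS.:= ℕS.con 2 ℕS.:* (ℕS.con 2 ℕS.:* (k ℕS.:* k))) refl k ⟩
      2 ℕ.* (2 ℕ.* (k ℕ.* k)) ∎)
      where module ℕS = ℕ.+-*-Solver
    n≢0 : n ≢ 0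
    n≢0 n≡0 = contradiction (trans eq (cong (λ x → 2 ℕ.* (x ℕ.* x)) n≡0)) λ ()
    n<m : n ℕ.< m
    -- If `m ≤ n`, then m² ≤ n² < 2n², where the strict step uses n² ≠ 0.
    n<m = ℕ.≰⇒> λ m≤n → ℕ.<-irrefl eq (ℕ.≤-<-trans (ℕ.*-mono-≤ m≤n m≤n)
      (subst (n ℕ.* n ℕ.<_) (ℕ.*-comm (n ℕ.* n) 2) (ℕ.m<m*n (n ℕ.* n) 2 (ℕ.s<s ℕ.z<s))))
      where instance
        _ = ℕ.≢-nonZero n≢0
        _ = ℕ.m*n≢0 n n

-- For `D ≠ 0` this says that the binary form X² - D Y² has no nontrivial integer zero.
Anisotropic : ℤ → Set
Anisotropic D = ∀ X Y → X ℤ.* X ≡ D ℤ.* (Y ℤ.* Y) → X ≡ 0ℤ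

i*i≡∣i∣*∣i∣ : ∀ i → i ℤ.* i ≡ + (ℤ.∣ i ∣ ℕ.* ℤ.∣ i ∣)
i*i≡∣i∣*∣i∣ (+ n) = sym (ℤ.pos-* n n)
i*i≡∣i∣*∣i∣ -[1+ n ] = refl

-- Since 8Y² = 2(2Y)², this is the irrationality of √2.
anisotropic-8 : Anisotropic (+ 8)
anisotropic-8 X Y eq = ℤ.∣i∣≡0⇒i≡0 (m²≡2n²⇒m≡0 x (2 ℕ.* y) (ℤ.+-injective (begin
  + (x ℕ.* x)                       ≡⟨ i*i≡∣i∣*∣i∣ X ⟨
  X ℤ.* X                           ≡⟨ eq ⟩
  + 8 ℤ.* (Y ℤ.* Y)                 ≡⟨ cong (+ 8 ℤ.*_) (i*i≡∣i∣*∣i∣ Y) ⟩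
  + 8 ℤ.* + (y ℕ.* y)               ≡⟨ ℤ.pos-* 8 (y ℕ.* y) ⟨
  + (8 ℕ.* (y ℕ.* y))               ≡⟨ cong +_ (ℕS.solve 1 (λ y → ℕS.con 8 ℕS.:* (y ℕS.:* y) ℕS.:=
                                         ℕS.con 2 ℕS.:* (ℕS.con 2 ℕS.:* y ℕS.:* (ℕS.con 2 ℕS.:* y))) refl y) ⟩
  + (2 ℕ.* (2 ℕ.* y ℕ.* (2 ℕ.* y))) ∎)))
  where
  x = ℤ.∣ X ∣
  y = ℤ.∣ Y ∣
  module ℕS = ℕ.+-*-Solver

-- X² + 4Y² is a sum of two nonnegative terms, so it is zero only if both are.
anisotropic--4 : Anisotropic -[1+ 3 ]
anisotropic--4 X Y eq = ℤ.∣i∣≡0⇒i≡0 (reduce (ℕ.m*n≡0⇒m≡0∨n≡0 x (ℕ.m+n≡0⇒m≡0 (x ℕ.* x) (ℤ.+-injective (begin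
  + (x ℕ.* x) ℤ.+ + (4 ℕ.* (y ℕ.* y))          ≡⟨ cong₂ ℤ._+_ (sym (i*i≡∣i∣*∣i∣ X))
                                                    (trans (ℤ.pos-* 4 (y ℕ.* y)) (cong (+ 4 ℤ.*_) (sym (i*i≡∣i∣*∣i∣ Y)))) ⟩
  X ℤ.* X ℤ.+ + 4 ℤ.* (Y ℤ.* Y)                ≡⟨ cong (ℤ._+ + 4 ℤ.* (Y ℤ.* Y)) eq ⟩
  -[1+ 3 ] ℤ.* (Y ℤ.* Y) ℤ.+ + 4 ℤ.* (Y ℤ.* Y) ≡⟨ ℤ.*-distribʳ-+ (Y ℤ.* Y) -[1+ 3 ] (+ 4) ⟨
  0ℤ                                           ∎)))))
  where
  x = ℤ.∣ X ∣
  y = ℤ.∣ Y ∣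

-- For x = a / b and y = c / e, the equation is multiplied by b²e².
clear-denominators : ∀ x y b e d {a c} → x * b ≡ a → y * e ≡ c → x * x ≡ d * (y * y) →
                     a * e * (a * e) ≡ d * (c * b * (c * b))
clear-denominators x y b e d refl refl eq = begin
  x * b * e * (x * b * e)         ≡⟨ solve 3 (λ x b e → x :* b :* e :* (x :* b :* e) := b :* b :* (e :* e) :* (x :* x)) refl x b e ⟩
  b * b * (e * e) * (x * x)       ≡⟨ cong (b * b * (e * e) *_) eq ⟩
  b * b * (e * e) * (d * (y * y)) ≡⟨ solve 4 (λ y b e d → b :* b :* (e :* e) :* (d :* (y :* y)) := d :* (y :* e :* b :* (y :* e :* b))) refl y b e d ⟩
  d * (y * e * b * (y * e * b))   ∎

-- Multiplication by both denominators gives an integer solution with first entry `↥ x * ↧ y`, and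
-- `↧ y` is positive.
anisotropic-ℚ : ∀ {D} → Anisotropic D → ∀ x y → x * x ≡ fromℤ D * (y * y) → x ≡ 0ℚ
anisotropic-ℚ {D} aniso x y eq = ↥p≡0⇒p≡0 x ↥x≡0
  where
  square : ∀ m n → fromℤ (m ℤ.* n ℤ.* (m ℤ.* n)) ≡ fromℤ m * fromℤ n * (fromℤ m * fromℤ n)
  square m n = trans (fromℤ-homo-* (m ℤ.* n) (m ℤ.* n)) (cong₂ _*_ (fromℤ-homo-* m n) (fromℤ-homo-* m n))
  cleared : ↥ x ℤ.* ↧ y ℤ.* (↥ x ℤ.* ↧ y) ≡ D ℤ.* (↥ y ℤ.* ↧ x ℤ.* (↥ y ℤ.* ↧ x))
  cleared = fromℤ-injective (trans (square (↥ x) (↧ y)) (trans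
    (clear-denominators x y (fromℤ (↧ x)) (fromℤ (↧ y)) (fromℤ D) (q*↧q≡↥q x) (q*↧q≡↥q y) eq)
    (sym (trans (fromℤ-homo-* D (↥ y ℤ.* ↧ x ℤ.* (↥ y ℤ.* ↧ x))) (cong (fromℤ D *_) (square (↥ y) (↧ x)))))))
  ↥x≡0 : ↥ x ≡ 0ℤ
  ↥x≡0 with ℤ.i*j≡0⇒i≡0∨j≡0 (↥ x) (aniso (↥ x ℤ.* ↧ y) (↥ y ℤ.* ↧ x) cleared)
  ... | inj₁ ↥x≡0 = ↥x≡0
  ... | inj₂ ()

-- Rational spans of integer vectors

infix 8 _·_
_·_ : ∀ {n} → Vec ℤ n → Vec ℤ n → ℤ
[] · [] = 0ℤ
-- Redundant, but it speeds up the evaluation of the search considerably.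
(+ 0 ∷ xs) · (_ ∷ ys) = xs · ys
(x ∷ xs) · (y ∷ ys) = x ℤ.* y ℤ.+ xs · ys

infix 8 _∙_
_∙_ : ∀ {n} → Vec ℤ n → Vec ℚ n → ℚ
[] ∙ [] = 0ℚ
(x ∷ xs) ∙ (y ∷ ys) = fromℤ x * y + xs ∙ ys

infixr 8 _•_
_•_ : ∀ {n} → ℚ → Vec ℤ n → Vec ℚ n
t • b = Vec.map (λ x → t * fromℤ x) b

infixr 6 _⊞_
_⊞_ : ∀ {n} → Vec ℚ n → Vec ℚ n → Vec ℚ n
_⊞_ = Vec.zipWith _+_

𝟎 : ∀ {n} → Vec ℚ n
𝟎 {n} = Vec.replicate n 0ℚ

-- The vector is an index built by the constructors, so that matching on a proof replaces it by an
-- explicit combination with known coefficients.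
data Span {n} : List (Vec ℤ n) → Vec ℚ n → Set where
  []  : Span [] 𝟎
  _∷_ : ∀ {b bs d} t → Span bs d → Span (b ∷ bs) (t • b ⊞ d)

combine : ∀ {n} → ℤ → ℤ → Vec ℤ n → Vec ℤ n → Vec ℤ n
combine c c′ = Vec.zipWith (λ x y → c ℤ.* x ℤ.- c′ ℤ.* y)

eliminate : ∀ {n} → ℤ → Vec ℤ n → ℤ → Vec ℤ n → Vec ℤ n
eliminate c b c′ b′ with c′ ℤ.≟ 0ℤ
... | yes _ = b′
... | no _ = combine c c′ b′ b

-- Spans the part of the given span on which `w` vanishes. The first vector with `w · b ≢ 0` is the
-- pivot: it is used to correct the later vectors and is then dropped.
restrict : ∀ {n} → Vec ℤ n → List (Vec ℤ n) → List (Vec ℤ n)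
restrict w [] = []
restrict w (b ∷ bs) with w · b ℤ.≟ 0ℤ
... | yes _ = b ∷ restrict w bs
... | no _ = map (λ b′ → eliminate (w · b) b (w · b′) b′) bs

units : ∀ n → List (Vec ℤ n)
units zero = []
units (suc n) = (1ℤ ∷ Vec.replicate n 0ℤ) ∷ map (0ℤ ∷_) (units n)

·-∷ : ∀ {n} x (xs : Vec ℤ n) y ys → (x ∷ xs) · (y ∷ ys) ≡ x ℤ.* y ℤ.+ xs · ys
·-∷ (+ 0) xs y ys = sym (ℤ.+-identityˡ (xs · ys))
·-∷ ℤ.+[1+ _ ] _ _ _ = refl
·-∷ -[1+ _ ] _ _ _ = refl

fromℤ-·-∷ : ∀ {n} x (xs : Vec ℤ n) y ys →
            fromℤ ((x ∷ xs) · (y ∷ ys)) ≡ fromℤ x * fromℤ y + fromℤ (xs · ys)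
fromℤ-·-∷ x xs y ys = begin
  fromℤ ((x ∷ xs) · (y ∷ ys))         ≡⟨ cong fromℤ (·-∷ x xs y ys) ⟩
  fromℤ (x ℤ.* y ℤ.+ xs · ys)         ≡⟨ fromℤ-homo-+ (x ℤ.* y) (xs · ys) ⟩
  fromℤ (x ℤ.* y) + fromℤ (xs · ys)   ≡⟨ cong (_+ fromℤ (xs · ys)) (fromℤ-homo-* x y) ⟩
  fromℤ x * fromℤ y + fromℤ (xs · ys) ∎

∙-linear : ∀ {n} (w : Vec ℤ n) t b d → w ∙ (t • b ⊞ d) ≡ t * fromℤ (w · b) + w ∙ d
∙-linear [] t [] [] = sym (trans (+-identityʳ (t * 0ℚ)) (*-zeroʳ t))
∙-linear (x ∷ w) t (y ∷ b) (z ∷ d) = begin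
  fromℤ x * (t * fromℤ y + z) + w ∙ (t • b ⊞ d)
    ≡⟨ cong (λ q → fromℤ x * (t * fromℤ y + z) + q) (∙-linear w t b d) ⟩
  fromℤ x * (t * fromℤ y + z) + (t * fromℤ (w · b) + w ∙ d)
    ≡⟨ regroup (fromℤ x) t (fromℤ y) z (fromℤ (w · b)) (w ∙ d) ⟩
  t * (fromℤ x * fromℤ y + fromℤ (w · b)) + (fromℤ x * z + w ∙ d)
    ≡⟨ cong (λ q → t * q + (fromℤ x * z + w ∙ d)) (fromℤ-·-∷ x w y b) ⟨
  t * fromℤ ((x ∷ w) · (y ∷ b)) + (fromℤ x * z + w ∙ d) ∎
  where
  regroup : ∀ x t y z p q → x * (t * y + z) + (t * p + q) ≡ t * (x * y + p) + (x * z + q)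
  regroup = solve 6 (λ x t y z p q → x :* (t :* y :+ z) :+ (t :* p :+ q) := t :* (x :* y :+ p) :+ (x :* z :+ q)) refl

∙-𝟎 : ∀ {n} (w : Vec ℤ n) → w ∙ 𝟎 ≡ 0ℚ
∙-𝟎 [] = refl
∙-𝟎 (x ∷ w) = trans (cong₂ _+_ (*-zeroʳ (fromℤ x)) (∙-𝟎 w)) (+-identityˡ 0ℚ)

∙-neg : ∀ {n} (w : Vec ℤ n) d → Vec.map ℤ.-_ w ∙ d ≡ - (w ∙ d)
∙-neg [] [] = refl
∙-neg (x ∷ w) (y ∷ d) = trans (cong₂ (λ a b → a * y + b) (fromℤ-homo-neg x) (∙-neg w d))
  (solve 3 (λ x y z → :- x :* y :+ :- z := :- (x :* y :+ z)) refl (fromℤ x) y (w ∙ d))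

•-zeroˡ : ∀ {n} (b : Vec ℤ n) d → 0ℚ • b ⊞ d ≡ d
•-zeroˡ [] [] = refl
•-zeroˡ (x ∷ b) (y ∷ d) = cong₂ _∷_ (trans (cong (_+ y) (*-zeroˡ (fromℤ x))) (+-identityˡ y)) (•-zeroˡ b d)

•-zeroʳ : ∀ {n} t (d : Vec ℚ n) → t • Vec.replicate n 0ℤ ⊞ d ≡ d
•-zeroʳ t [] = refl
•-zeroʳ t (x ∷ d) = cong₂ _∷_ (trans (cong (_+ x) (*-zeroʳ t)) (+-identityˡ x)) (•-zeroʳ t d)

⊞-swap : ∀ {n} (u v d : Vec ℚ n) → u ⊞ v ⊞ d ≡ v ⊞ u ⊞ d
⊞-swap [] [] [] = refl
⊞-swap (x ∷ u) (y ∷ v) (z ∷ d) =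
  cong₂ _∷_ (solve 3 (λ x y z → x :+ (y :+ z) := y :+ (x :+ z)) refl x y z) (⊞-swap u v d)

•-distrib-combine : ∀ {n} u c c′ (b′ b : Vec ℤ n) d →
                    u • combine c c′ b′ b ⊞ d ≡ (u * fromℤ c) • b′ ⊞ (u * - fromℤ c′) • b ⊞ d
•-distrib-combine u c c′ [] [] [] = refl
•-distrib-combine u c c′ (x′ ∷ b′) (x ∷ b) (z ∷ d) = cong₂ _∷_
  (trans (cong (λ q → u * q + z) (fromℤ-minor c x′ c′ x))
         (expand u (fromℤ c) (fromℤ c′) (fromℤ x′) (fromℤ x) z))
  (•-distrib-combine u c c′ b′ b d)
  where
  expand : ∀ u c c′ x′ x z → u * (c * x′ - c′ * x) + z ≡ u * c * x′ + (u * - c′ * x + z)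
  expand = solve 6 (λ u c c′ x′ x z → u :* (c :* x′ :- c′ :* x) :+ z := u :* c :* x′ :+ (u :* :- c′ :* x :+ z)) refl

•-distribʳ-+ : ∀ {n} s t (b : Vec ℤ n) d → s • b ⊞ t • b ⊞ d ≡ (s + t) • b ⊞ d
•-distribʳ-+ s t [] [] = refl
•-distribʳ-+ s t (x ∷ b) (z ∷ d) = cong₂ _∷_ (merge s t (fromℤ x) z) (•-distribʳ-+ s t b d)
  where
  merge : ∀ s t x z → s * x + (t * x + z) ≡ (s + t) * x + z
  merge = solve 4 (λ s t x z → s :* x :+ (t :* x :+ z) := (s :+ t) :* x :+ z) refl

∙-Span : ∀ {n bs d} (w : Vec ℤ n) → All (λ b → w · b ≡ 0ℤ) bs → Span bs d → w ∙ d ≡ 0ℚ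
∙-Span w [] [] = ∙-𝟎 w
∙-Span w (_∷_ {x = b} w·b≡0 ws) (_∷_ {d = d} t sp) = begin
  w ∙ (t • b ⊞ d)           ≡⟨ ∙-linear w t b d ⟩
  t * fromℤ (w · b) + w ∙ d ≡⟨ cong₂ (λ z q → t * fromℤ z + q) w·b≡0 (∙-Span w ws sp) ⟩
  t * 0ℚ + 0ℚ               ≡⟨ trans (+-identityʳ (t * 0ℚ)) (*-zeroʳ t) ⟩
  0ℚ                        ∎

-- The multiple of b is the one that makes w vanish on the result.
eliminate-Span : ∀ {n} (w b : Vec ℤ n) k → k * fromℤ (w · b) ≡ 1ℚ → ∀ {bs d} → Span bs d →
                 Span (map (λ b′ → eliminate (w · b) b (w · b′) b′) bs) ((- (k * w ∙ d)) • b ⊞ d)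
eliminate-Span w b k kc≡1 [] = subst (Span []) (sym (trans
  (cong (λ q → (- q) • b ⊞ 𝟎) (trans (cong (k *_) (∙-𝟎 w)) (*-zeroʳ k))) (•-zeroˡ b 𝟎))) []
eliminate-Span w b k kc≡1 (_∷_ {b′} {d = d} s sp) with w · b′ ℤ.≟ 0ℤ | eliminate-Span w b k kc≡1 sp
... | yes w·b′≡0 | sp′ = subst (Span _) (begin
  s • b′ ⊞ (- (k * w ∙ d)) • b ⊞ d            ≡⟨ ⊞-swap (s • b′) ((- (k * w ∙ d)) • b) d ⟩
  (- (k * w ∙ d)) • b ⊞ s • b′ ⊞ d            ≡⟨ cong (λ q → (- (k * q)) • b ⊞ s • b′ ⊞ d) same ⟨
  (- (k * w ∙ (s • b′ ⊞ d))) • b ⊞ s • b′ ⊞ d ∎) (s ∷ sp′)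
  where
  same : w ∙ (s • b′ ⊞ d) ≡ w ∙ d
  same = trans (∙-linear w s b′ d) (trans (cong (λ z → s * fromℤ z + w ∙ d) w·b′≡0)
    (trans (cong (_+ w ∙ d) (*-zeroʳ s)) (+-identityˡ (w ∙ d))))
-- The coefficient `s` of `b′` becomes `k * s`, which undoes the factor `c` that `combine` puts on
-- `b′`.
... | no _ | sp′ = subst (Span _) (begin
  (k * s) • combine c c′ b′ b ⊞ (- (k * w ∙ d)) • b ⊞ d
    ≡⟨ •-distrib-combine (k * s) c c′ b′ b ((- (k * w ∙ d)) • b ⊞ d) ⟩
  (k * s * fromℤ c) • b′ ⊞ (k * s * - fromℤ c′) • b ⊞ (- (k * w ∙ d)) • b ⊞ d
    ≡⟨ cong₂ (λ q v → q • b′ ⊞ v) (cancel k s (fromℤ c) kc≡1) (•-distribʳ-+ (k * s * - fromℤ c′) (- (k * w ∙ d)) b d) ⟩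
  s • b′ ⊞ (k * s * - fromℤ c′ + - (k * w ∙ d)) • b ⊞ d
    ≡⟨ ⊞-swap (s • b′) ((k * s * - fromℤ c′ + - (k * w ∙ d)) • b) d ⟩
  (k * s * - fromℤ c′ + - (k * w ∙ d)) • b ⊞ s • b′ ⊞ d
    ≡⟨ cong (λ q → q • b ⊞ s • b′ ⊞ d) (factor k s (fromℤ c′) (w ∙ d)) ⟩
  (- (k * (s * fromℤ c′ + w ∙ d))) • b ⊞ s • b′ ⊞ d
    ≡⟨ cong (λ q → (- (k * q)) • b ⊞ s • b′ ⊞ d) (∙-linear w s b′ d) ⟨
  (- (k * w ∙ (s • b′ ⊞ d))) • b ⊞ s • b′ ⊞ d ∎) (k * s ∷ sp′)
  where
  c = w · b
  c′ = w · b′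
  cancel : ∀ k s c → k * c ≡ 1ℚ → k * s * c ≡ s
  cancel k s c kc≡1 = trans (solve 3 (λ k s c → k :* s :* c := k :* c :* s) refl k s c)
    (trans (cong (_* s) kc≡1) (*-identityˡ s))
  factor : ∀ k s c e → k * s * - c + - (k * e) ≡ - (k * (s * c + e))
  factor = solve 4 (λ k s c e → k :* s :* :- c :+ :- (k :* e) := :- (k :* (s :* c :+ e))) refl

-- At the pivot, the vanishing of `w` determines the coefficient `t` from the rest of the
-- combination. It is the coefficient with which `eliminate-Span` adds the pivot, so the vector
-- survives without the pivot in the list.
restrict-Span : ∀ {n} (w : Vec ℤ n) {bs d} → w ∙ d ≡ 0ℚ → Span bs d → Span (restrict w bs) d
restrict-Span w w∙d≡0 [] = []
restrict-Span w w∙d≡0 (_∷_ {b} {d = d} t sp) with w · b ℤ.≟ 0ℤ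
... | yes w·b≡0 = t ∷ restrict-Span w (begin
  w ∙ d                     ≡⟨ +-identityˡ (w ∙ d) ⟨
  0ℚ + w ∙ d                ≡⟨ cong (_+ w ∙ d) (*-zeroʳ t) ⟨
  t * fromℤ 0ℤ + w ∙ d      ≡⟨ cong (λ z → t * fromℤ z + w ∙ d) w·b≡0 ⟨
  t * fromℤ (w · b) + w ∙ d ≡⟨ ∙-linear w t b d ⟨
  w ∙ (t • b ⊞ d)           ≡⟨ w∙d≡0 ⟩
  0ℚ                        ∎) sp
... | no w·b≢0 with k , kc≡1 ← inverse (fromℤ-≢0 w·b≢0) =
  subst (λ q → Span _ (q • b ⊞ d))
    (solve-for k t (fromℤ (w · b)) (w ∙ d) kc≡1 (trans (sym (∙-linear w t b d)) w∙d≡0))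
    (eliminate-Span w b k kc≡1 sp)
  where
  solve-for : ∀ k t c e → k * c ≡ 1ℚ → t * c + e ≡ 0ℚ → - (k * e) ≡ t
  solve-for k t c e kc≡1 tc+e≡0 = begin
    - (k * e)                   ≡⟨ solve 4 (λ k t c e → :- (k :* e) := k :* c :* t :- k :* (t :* c :+ e)) refl k t c e ⟩
    k * c * t - k * (t * c + e) ≡⟨ cong₂ (λ p q → p * t - k * q) kc≡1 tc+e≡0 ⟩
    1ℚ * t - k * 0ℚ             ≡⟨ solve 2 (λ k t → con 1ℚ :* t :- k :* con 0ℚ := t) refl k t ⟩
    t                           ∎

Span-0∷ : ∀ {n} {bs : List (Vec ℤ n)} {d} → Span bs d → Span (map (0ℤ ∷_) bs) (0ℚ ∷ d)
Span-0∷ [] = []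
Span-0∷ (_∷_ {b} {bs} {d} t sp) = subst (λ q → Span (map (0ℤ ∷_) (b ∷ bs)) (q ∷ (t • b ⊞ d)))
  (trans (+-identityʳ (t * 0ℚ)) (*-zeroʳ t)) (t ∷ Span-0∷ sp)

Span-units : ∀ {n} (d : Vec ℚ n) → Span (units n) d
Span-units [] = []
Span-units (x ∷ d) = subst (Span _)
  (cong₂ _∷_ (trans (+-identityʳ (x * 1ℚ)) (*-identityʳ x)) (•-zeroʳ x d)) (x ∷ Span-0∷ (Span-units d))

-- The Plücker quadric

ℤ⁶ ℚ⁶ : Set
ℤ⁶ = Vec ℤ 6
ℚ⁶ = Vec ℚ 6

-- The coordinates are indexed by 12, 13, 14, 23, 24, 34.
quadric : ℤ⁶ → ℤ
quadric (a ∷ b ∷ c ∷ d ∷ e ∷ f ∷ []) = a ℤ.* f ℤ.- b ℤ.* e ℤ.+ c ℤ.* d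

-- The polarization of `quadric`, that is, the mixed term of its value at a sum.
polar : ℤ⁶ → ℤ⁶ → ℤ
polar (a ∷ b ∷ c ∷ d ∷ e ∷ f ∷ []) (a′ ∷ b′ ∷ c′ ∷ d′ ∷ e′ ∷ f′ ∷ []) =
  (a ℤ.* f′ ℤ.- b ℤ.* e′ ℤ.+ c ℤ.* d′) ℤ.+ (a′ ℤ.* f ℤ.- b′ ℤ.* e ℤ.+ c′ ℤ.* d)

quadricℚ : ℚ⁶ → ℚ
quadricℚ (a ∷ b ∷ c ∷ d ∷ e ∷ f ∷ []) = a * f - b * e + c * d

fromℤ-quadric : ∀ a f b e c d → fromℤ (a ℤ.* f ℤ.- b ℤ.* e ℤ.+ c ℤ.* d) ≡
                fromℤ a * fromℤ f - fromℤ b * fromℤ e + fromℤ c * fromℤ d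
fromℤ-quadric a f b e c d = trans (fromℤ-homo-+ (a ℤ.* f ℤ.- b ℤ.* e) (c ℤ.* d))
  (cong₂ _+_ (fromℤ-minor a f b e) (fromℤ-homo-* c d))

quadricℚ-line : ∀ t b → quadricℚ (t • b ⊞ 𝟎) ≡ t * t * fromℤ (quadric b)
quadricℚ-line t (a ∷ b ∷ c ∷ d ∷ e ∷ f ∷ []) = trans
  (expand t (fromℤ a) (fromℤ b) (fromℤ c) (fromℤ d) (fromℤ e) (fromℤ f))
  (cong (t * t *_) (sym (fromℤ-quadric a f b e c d)))
  where
  expand : ∀ t a b c d e f →
    (t * a + 0ℚ) * (t * f + 0ℚ) - (t * b + 0ℚ) * (t * e + 0ℚ) + (t * c + 0ℚ) * (t * d + 0ℚ) ≡
    t * t * (a * f - b * e + c * d)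
  expand = solve 7 (λ t a b c d e f →
    (t :* a :+ con 0ℚ) :* (t :* f :+ con 0ℚ) :- (t :* b :+ con 0ℚ) :* (t :* e :+ con 0ℚ) :+
    (t :* c :+ con 0ℚ) :* (t :* d :+ con 0ℚ) :=
    t :* t :* (a :* f :- b :* e :+ c :* d)) refl

quadricℚ-pencil : ∀ s t b b′ → quadricℚ (s • b ⊞ t • b′ ⊞ 𝟎) ≡
  fromℤ (quadric b) * (s * s) + fromℤ (polar b b′) * (s * t) + fromℤ (quadric b′) * (t * t)
quadricℚ-pencil s t (a ∷ b ∷ c ∷ d ∷ e ∷ f ∷ []) (a′ ∷ b′ ∷ c′ ∷ d′ ∷ e′ ∷ f′ ∷ []) = begin
  quadricℚ (s • (a ∷ b ∷ c ∷ d ∷ e ∷ f ∷ []) ⊞ t • (a′ ∷ b′ ∷ c′ ∷ d′ ∷ e′ ∷ f′ ∷ []) ⊞ 𝟎)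
    ≡⟨ cong₂ _+_ (cong₂ (λ p q → p - q)
         (product s t (fromℤ a) (fromℤ a′) (fromℤ f) (fromℤ f′))
         (product s t (fromℤ b) (fromℤ b′) (fromℤ e) (fromℤ e′)))
         (product s t (fromℤ c) (fromℤ c′) (fromℤ d) (fromℤ d′)) ⟩
  -- The products of coordinates enter `gather` as single variables, which keeps the degree of the
  -- identity low.
  _ ≡⟨ gather (s * s) (s * t) (t * t)
         (fromℤ a * fromℤ f) (fromℤ a * fromℤ f′) (fromℤ a′ * fromℤ f) (fromℤ a′ * fromℤ f′)
         (fromℤ b * fromℤ e) (fromℤ b * fromℤ e′) (fromℤ b′ * fromℤ e) (fromℤ b′ * fromℤ e′)
         (fromℤ c * fromℤ d) (fromℤ c * fromℤ d′) (fromℤ c′ * fromℤ d) (fromℤ c′ * fromℤ d′) ⟩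
  _ ≡⟨ cong₂ _+_ (cong₂ _+_ (cong (_* (s * s)) (fromℤ-quadric a f b e c d))
         (cong (_* (s * t)) (trans
           (fromℤ-homo-+ (a ℤ.* f′ ℤ.- b ℤ.* e′ ℤ.+ c ℤ.* d′) (a′ ℤ.* f ℤ.- b′ ℤ.* e ℤ.+ c′ ℤ.* d))
           (cong₂ _+_ (fromℤ-quadric a f′ b e′ c d′) (fromℤ-quadric a′ f b′ e c′ d)))))
         (cong (_* (t * t)) (fromℤ-quadric a′ f′ b′ e′ c′ d′)) ⟨
  _ ∎
  where
  product : ∀ s t x x′ y y′ → (s * x + (t * x′ + 0ℚ)) * (s * y + (t * y′ + 0ℚ)) ≡
            s * s * (x * y) + s * t * (x * y′ + x′ * y) + t * t * (x′ * y′)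
  product = solve 6 (λ s t x x′ y y′ →
    (s :* x :+ (t :* x′ :+ con 0ℚ)) :* (s :* y :+ (t :* y′ :+ con 0ℚ)) :=
    s :* s :* (x :* y) :+ s :* t :* (x :* y′ :+ x′ :* y) :+ t :* t :* (x′ :* y′)) refl
  gather : ∀ p q r x₁ x₂ x₃ x₄ y₁ y₂ y₃ y₄ z₁ z₂ z₃ z₄ →
    (p * x₁ + q * (x₂ + x₃) + r * x₄) - (p * y₁ + q * (y₂ + y₃) + r * y₄) + (p * z₁ + q * (z₂ + z₃) + r * z₄) ≡
    (x₁ - y₁ + z₁) * p + ((x₂ - y₂ + z₂) + (x₃ - y₃ + z₃)) * q + (x₄ - y₄ + z₄) * r
  gather = solve 15 (λ p q r x₁ x₂ x₃ x₄ y₁ y₂ y₃ y₄ z₁ z₂ z₃ z₄ →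
    (p :* x₁ :+ q :* (x₂ :+ x₃) :+ r :* x₄) :- (p :* y₁ :+ q :* (y₂ :+ y₃) :+ r :* y₄) :+
    (p :* z₁ :+ q :* (z₂ :+ z₃) :+ r :* z₄) :=
    (x₁ :- y₁ :+ z₁) :* p :+ ((x₂ :- y₂ :+ z₂) :+ (x₃ :- y₃ :+ z₃)) :* q :+ (x₄ :- y₄ :+ z₄) :* r) refl

-- The search

-- A member of D lists linear forms that vanish together at d only if d = 0.
Admissible : List (List ℤ⁶) → ℚ⁶ → Set
Admissible D d = quadricℚ d ≡ 0ℚ × All (λ ws → All (λ w → w ∙ d ≡ 0ℚ) ws → d ≡ 𝟎) D

Vanishes : List ℤ⁶ → ℤ⁶ → Set
Vanishes bs w = All (λ b → w · b ≡ 0ℤ) bs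

vanishes? : ∀ bs w → Dec (Vanishes bs w)
vanishes? bs w = All.all? (λ b → w · b ℤ.≟ 0ℤ) bs

-- A sufficient condition for the span to meet the quadric only in zero, claimed for at most one
-- spanning vector.
OffQuadric : List ℤ⁶ → Set
OffQuadric [] = ⊤
OffQuadric (b ∷ []) = quadric b ≢ 0ℤ
OffQuadric (_ ∷ _ ∷ _) = ⊥

offQuadric? : ∀ bs → Dec (OffQuadric bs)
offQuadric? [] = yes _
offQuadric? (b ∷ []) = ¬? (quadric b ℤ.≟ 0ℤ)
offQuadric? (_ ∷ _ ∷ _) = no λ ()

-- Each Settled* predicate is a certificate that an admissible d in the span is zero.
Settled : List (List ℤ⁶) → List ℤ⁶ → Set
Settled D bs = OffQuadric bs ⊎ Any (All (Vanishes bs)) D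

settled? : ∀ D bs → Dec (Settled D bs)
settled? D bs = offQuadric? bs ⊎-dec Any.any? (All.all? (vanishes? bs)) D

-- For the vectors s b + t b′ with l s + m t = 0.
SettledLine : List (List ℤ⁶) → ℤ⁶ → ℤ⁶ → ℤ → ℤ → Set
SettledLine D b b′ l m = (l ≢ 0ℤ ⊎ m ≢ 0ℤ) × Settled D (combine l m b′ b ∷ [])

settledLine? : ∀ D b b′ l m → Dec (SettledLine D b b′ l m)
settledLine? D b b′ l m =
  (¬? (l ℤ.≟ 0ℤ) ⊎-dec ¬? (m ℤ.≟ 0ℤ)) ×-dec settled? D (combine l m b′ b ∷ [])

-- B² - 4AC, with 4AC written as 2A · 2C by sums, so that no numeral has to be carried over to ℚ.
discriminant : ℤ → ℤ → ℤ → ℤ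
discriminant A B C = B ℤ.* B ℤ.- (A ℤ.+ A) ℤ.* (C ℤ.+ C)

-- For the vectors s b + t b′ with A s² + B s t + C t² = 0.  The discriminants
-- listed are those that the search meets when A ≠ 0.
SettledConic : List (List ℤ⁶) → ℤ⁶ → ℤ⁶ → ℤ → ℤ → ℤ → Set
SettledConic D b b′ A B C =
  (A ≡ 0ℤ × Settled D (b ∷ []) × SettledLine D b b′ B C) ⊎
  Any (λ r → discriminant A B C ≡ r ℤ.* r ×
             SettledLine D b b′ (A ℤ.+ A) (B ℤ.- r) × SettledLine D b b′ (A ℤ.+ A) (B ℤ.+ r))
      (+ 0 ∷ + 1 ∷ + 2 ∷ []) ⊎
  Any (discriminant A B C ≡_) (+ 8 ∷ -[1+ 3 ] ∷ []) × SettledLine D b b′ (A ℤ.+ A) B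

settledConic? : ∀ D b b′ A B C → Dec (SettledConic D b b′ A B C)
settledConic? D b b′ A B C =
  (A ℤ.≟ 0ℤ ×-dec settled? D (b ∷ []) ×-dec settledLine? D b b′ B C) ⊎-dec
  Any.any? (λ r → discriminant A B C ℤ.≟ r ℤ.* r ×-dec
                  settledLine? D b b′ (A ℤ.+ A) (B ℤ.- r) ×-dec settledLine? D b b′ (A ℤ.+ A) (B ℤ.+ r))
           (+ 0 ∷ + 1 ∷ + 2 ∷ []) ⊎-dec
  (Any.any? (discriminant A B C ℤ.≟_) (+ 8 ∷ -[1+ 3 ] ∷ []) ×-dec settledLine? D b b′ (A ℤ.+ A) B)

SettledPencil : List (List ℤ⁶) → List ℤ⁶ → Set
SettledPencil D (b ∷ b′ ∷ []) = SettledConic D b b′ (quadric b) (polar b b′) (quadric b′)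
SettledPencil D _ = ⊥

settledPencil? : ∀ D bs → Dec (SettledPencil D bs)
settledPencil? D (b ∷ b′ ∷ []) = settledConic? D b b′ (quadric b) (polar b b′) (quadric b′)
settledPencil? D [] = no λ ()
settledPencil? D (_ ∷ []) = no λ ()
settledPencil? D (_ ∷ _ ∷ _ ∷ _) = no λ ()

-- Each list in the second argument offers the forms one of which vanishes at d.
-- A Bool rather than a Dec, whose suspended proofs would exhaust the memory.
refutes : List (List ℤ⁶) → List (List ℤ⁶) → List ℤ⁶ → Bool
refutes D [] bs = ⌊ settledPencil? D bs ⌋
refutes D (ws ∷ wss) bs =
  -- An offered form that already vanishes on the span leaves it unchanged, so its branch covers all
  -- the others.
  if ⌊ Any.any? (vanishes? bs) ws ⌋ then refutes D wss bs
  else all (λ bs′ → ⌊ settled? D bs′ ⌋ ∨ refutes D wss bs′) (map (λ w → restrict w bs) ws)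

-- Soundness of the search

degenerate-sound : ∀ {D bs d} → Any (All (Vanishes bs)) D → Span bs d →
                   All (λ ws → All (λ w → w ∙ d ≡ 0ℚ) ws → d ≡ 𝟎) D → d ≡ 𝟎
degenerate-sound (here vs) sp (h ∷ _) = h (All.map (λ {w} v → ∙-Span w v sp) vs)
degenerate-sound (there deg) sp (_ ∷ hs) = degenerate-sound deg sp hs

settled-sound : ∀ {D bs d} → Settled D bs → Span bs d → Admissible D d → d ≡ 𝟎
settled-sound (inj₂ deg) sp (_ , adm) = degenerate-sound deg sp adm
settled-sound (inj₁ _) [] _ = refl
settled-sound (inj₁ b-off) (_∷_ {b} t []) (d-on , _) = trans (cong (λ t → t • b ⊞ 𝟎) t≡0) (•-zeroˡ b 𝟎)
  where
  -- On the line through `b` the quadric is t² times the nonzero number `quadric b`, so t² = 0.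
  t≡0 : t ≡ 0ℚ
  t≡0 = reduce (p*q≡0⇒p≡0∨q≡0 t (p*q≡0⇒q≡0 (fromℤ-≢0 b-off)
    (trans (*-comm (fromℤ (quadric b)) (t * t)) (trans (sym (quadricℚ-line t b)) d-on))))
settled-sound (inj₁ ()) (_ ∷ _ ∷ _) _

-- As `l` and `m` are not both zero, every solution (s , t) of the equation is a multiple of (-m ,
-- l). The vector is thus a multiple of the single vector l b′ - m b.
line-sound : ∀ {D b b′ l m} → SettledLine D b b′ l m → ∀ s t → fromℤ l * s + fromℤ m * t ≡ 0ℚ →
             Admissible D (s • b ⊞ t • b′ ⊞ 𝟎) → s • b ⊞ t • b′ ⊞ 𝟎 ≡ 𝟎
line-sound {b = b} {b′} {l} {m} (lm≢0 , settled) s t eq =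
  let u , t≡ul , s≡um = proportional (fromℤ l) (- fromℤ m) t s
        (Sum.map fromℤ-≢0 (λ m≢0 → fromℤ-≢0 m≢0 ∘ neg-injective) lm≢0)
        (trans (sign (fromℤ l) (fromℤ m) s t) eq)
  in settled-sound settled (subst (Span _) (begin
    u • combine l m b′ b ⊞ 𝟎                     ≡⟨ •-distrib-combine u l m b′ b 𝟎 ⟩
    (u * fromℤ l) • b′ ⊞ (u * - fromℤ m) • b ⊞ 𝟎 ≡⟨ cong₂ (λ p q → p • b′ ⊞ q • b ⊞ 𝟎) t≡ul s≡um ⟨
    t • b′ ⊞ s • b ⊞ 𝟎                           ≡⟨ ⊞-swap (t • b′) (s • b) 𝟎 ⟩
    s • b ⊞ t • b′ ⊞ 𝟎                           ∎) (u ∷ []))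
  where
  sign : ∀ l m s t → l * s - - m * t ≡ l * s + m * t
  sign = solve 4 (λ l m s t → l :* s :- :- m :* t := l :* s :+ m :* t) refl

fromℤ-discriminant : ∀ A B C → fromℤ (discriminant A B C) ≡
                     fromℤ B * fromℤ B - (fromℤ A + fromℤ A) * (fromℤ C + fromℤ C)
fromℤ-discriminant A B C = trans (fromℤ-minor B B (A ℤ.+ A) (C ℤ.+ C))
  (cong (λ q → fromℤ B * fromℤ B - q) (cong₂ _*_ (fromℤ-homo-+ A A) (fromℤ-homo-+ C C)))

-- The two sides differ by 4A times the binary quadratic form, where 4A is written as
-- `A + A + (A + A)`.
complete-square : ∀ A B C s t → A * (s * s) + B * (s * t) + C * (t * t) ≡ 0ℚ →
  ((A + A) * s + B * t) * ((A + A) * s + B * t) ≡ (B * B - (A + A) * (C + C)) * (t * t)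
complete-square A B C s t eq = begin
  ((A + A) * s + B * t) * ((A + A) * s + B * t)
    ≡⟨ solve 5 (λ A B C s t →
         ((A :+ A) :* s :+ B :* t) :* ((A :+ A) :* s :+ B :* t) :=
         (A :+ A :+ (A :+ A)) :* (A :* (s :* s) :+ B :* (s :* t) :+ C :* (t :* t)) :+
         (B :* B :- (A :+ A) :* (C :+ C)) :* (t :* t)) refl A B C s t ⟩
  (A + A + (A + A)) * (A * (s * s) + B * (s * t) + C * (t * t)) + (B * B - (A + A) * (C + C)) * (t * t)
    ≡⟨ cong (λ q → (A + A + (A + A)) * q + (B * B - (A + A) * (C + C)) * (t * t)) eq ⟩
  (A + A + (A + A)) * 0ℚ + (B * B - (A + A) * (C + C)) * (t * t)
    ≡⟨ solve 2 (λ a q → a :* con 0ℚ :+ q := q) refl (A + A + (A + A)) ((B * B - (A + A) * (C + C)) * (t * t)) ⟩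
  (B * B - (A + A) * (C + C)) * (t * t) ∎

difference-of-squares : ∀ A B r s t → ((A + A) * s + B * t) * ((A + A) * s + B * t) ≡ r * r * (t * t) →
                        ((A + A) * s + (B - r) * t) * ((A + A) * s + (B + r) * t) ≡ 0ℚ
difference-of-squares A B r s t eq = begin
  ((A + A) * s + (B - r) * t) * ((A + A) * s + (B + r) * t)
    ≡⟨ solve 5 (λ A B r s t →
         ((A :+ A) :* s :+ (B :- r) :* t) :* ((A :+ A) :* s :+ (B :+ r) :* t) :=
         ((A :+ A) :* s :+ B :* t) :* ((A :+ A) :* s :+ B :* t) :- r :* r :* (t :* t)) refl A B r s t ⟩
  ((A + A) * s + B * t) * ((A + A) * s + B * t) - r * r * (t * t)
    ≡⟨ cong (_- r * r * (t * t)) eq ⟩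
  r * r * (t * t) - r * r * (t * t)
    ≡⟨ +-inverseʳ (r * r * (t * t)) ⟩
  0ℚ ∎

factor-t : ∀ B C s t → t * (B * s + C * t) ≡ 0ℚ * (s * s) + B * (s * t) + C * (t * t)
factor-t = solve 4 (λ B C s t → t :* (B :* s :+ C :* t) := con 0ℚ :* (s :* s) :+ B :* (s :* t) :+ C :* (t :* t)) refl

anisotropic : ∀ {Δ} → Any (Δ ≡_) (+ 8 ∷ -[1+ 3 ] ∷ []) → Anisotropic Δ
anisotropic (here refl) = anisotropic-8
anisotropic (there (here refl)) = anisotropic--4

-- In each case the vector is forced onto a settled line. For `A ≡ 0` the form is t (B s + C t). For
-- a discriminant r² it splits, up to the factor 4A, into 2A s + (B ∓ r) t. For the discriminants 8
-- and -4, completing the square and anisotropy over ℚ give 2A s + B t = 0.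
conic-sound : ∀ {D b b′ A B C} → SettledConic D b b′ A B C → ∀ s t →
              fromℤ A * (s * s) + fromℤ B * (s * t) + fromℤ C * (t * t) ≡ 0ℚ →
              Admissible D (s • b ⊞ t • b′ ⊞ 𝟎) → s • b ⊞ t • b′ ⊞ 𝟎 ≡ 𝟎
conic-sound {D} {b} {b′} {A} {B} {C} (inj₁ (A≡0 , settled , line)) s t eq adm =
  [ (λ t≡0 → settled-sound settled (subst (Span (b ∷ []))
      (cong (s • b ⊞_) (sym (trans (cong (λ t → t • b′ ⊞ 𝟎) t≡0) (•-zeroˡ b′ 𝟎)))) (s ∷ [])) adm)
  , (λ Bs+Ct≡0 → line-sound line s t Bs+Ct≡0 adm)
  ]′ (p*q≡0⇒p≡0∨q≡0 t (trans (factor-t (fromℤ B) (fromℤ C) s t)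
       (trans (cong (λ z → fromℤ z * (s * s) + fromℤ B * (s * t) + fromℤ C * (t * t)) (sym A≡0)) eq)))
conic-sound {D} {b} {b′} {A} {B} {C} (inj₂ (inj₁ square)) s t eq adm
  with r , Δ≡r² , line₁ , line₂ ← Any.satisfied square =
  [ (λ e → line-sound line₁ s t (trans (cong₂ (λ p q → p * s + q * t) (fromℤ-homo-+ A A) (fromℤ-homo-- B r)) e) adm)
  , (λ e → line-sound line₂ s t (trans (cong₂ (λ p q → p * s + q * t) (fromℤ-homo-+ A A) (fromℤ-homo-+ B r)) e) adm)
  ]′ (p*q≡0⇒p≡0∨q≡0 ((fromℤ A + fromℤ A) * s + (fromℤ B - fromℤ r) * t)
       (difference-of-squares (fromℤ A) (fromℤ B) (fromℤ r) s t
         (trans (complete-square (fromℤ A) (fromℤ B) (fromℤ C) s t eq)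
           (cong (_* (t * t)) (trans (sym (fromℤ-discriminant A B C)) (trans (cong fromℤ Δ≡r²) (fromℤ-homo-* r r)))))))
conic-sound {D} {b} {b′} {A} {B} {C} (inj₂ (inj₂ (nonsquare , line))) s t eq adm =
  line-sound line s t (trans (cong (λ p → p * s + fromℤ B * t) (fromℤ-homo-+ A A))
    (anisotropic-ℚ (anisotropic nonsquare) ((fromℤ A + fromℤ A) * s + fromℤ B * t) t
      (trans (complete-square (fromℤ A) (fromℤ B) (fromℤ C) s t eq)
        (cong (_* (t * t)) (sym (fromℤ-discriminant A B C)))))) adm

pencil-sound : ∀ {D bs d} → SettledPencil D bs → Span bs d → Admissible D d → d ≡ 𝟎
pencil-sound settled (_∷_ {b} s (_∷_ {b′} t [])) adm@(d-on , _) =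
  conic-sound settled s t (trans (sym (quadricℚ-pencil s t b b′)) d-on) adm
pencil-sound () (_ ∷ [])
pencil-sound () (_ ∷ _ ∷ _ ∷ _)

-- By induction on the list of alternatives: some offered form vanishes at `d`, so `d` remains in
-- the span restricted by that form, and the search has closed this branch.
refutes-sound : ∀ {D d} → Admissible D d → ∀ wss bs → refutes D wss bs ≡ true →
                All (Any (λ w → w ∙ d ≡ 0ℚ)) wss → Span bs d → d ≡ 𝟎
refutes-sound {D} adm [] bs r [] sp =
  pencil-sound {bs = bs} (toWitness {a? = settledPencil? D bs} (Equivalence.from T-≡ r)) sp adm
refutes-sound {D} {d} adm (ws ∷ wss) bs r (a ∷ as) sp with Any.any? (vanishes? bs) ws
... | yes _ = refutes-sound adm wss bs r as sp
... | no _ = branch a (All.map⁻ (All.all⁺ _ (map (λ w → restrict w bs) ws) (Equivalence.from T-≡ r)))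
  where
  branch : ∀ {ws} → Any (λ w → w ∙ d ≡ 0ℚ) ws →
           All (λ w → T (⌊ settled? D (restrict w bs) ⌋ ∨ refutes D wss (restrict w bs))) ws → d ≡ 𝟎
  branch (there a) (_ ∷ rs) = branch a rs
  branch (here {w} w∙d≡0) (r ∷ _) with Equivalence.to T-∨ r
  ... | inj₁ settled =
    settled-sound (toWitness {a? = settled? D (restrict w bs)} settled) (restrict-Span w w∙d≡0 sp) adm
  ... | inj₂ refuted =
    refutes-sound adm wss (restrict w bs) (Equivalence.to T-≡ refuted) as (restrict-Span w w∙d≡0 sp)

-- Determinants of plane vectors

det : ℚ² → ℚ² → ℚ
det (a , b) (c , d) = a * d - b * c

Parallel⇒det≡0 : ∀ {u v} → Parallel u v → det u v ≡ 0ℚ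
Parallel⇒det≡0 {v = a , b} (inj₁ (t , refl)) = solve 3 (λ t a b → t :* a :* b :- t :* b :* a := con 0ℚ) refl t a b
Parallel⇒det≡0 {u = a , b} (inj₂ (t , refl)) = solve 3 (λ t a b → a :* (t :* b) :- b :* (t :* a) := con 0ℚ) refl t a b

det≡0⇒multiple : ∀ u v → u ≢ 0ᵥ → det u v ≡ 0ℚ → ∃ λ t → v ≡ t *ᵥ u
det≡0⇒multiple (a , b) (c , d) u≢0 eq =
  map₂ (uncurry (cong₂ _,_)) (proportional a b c d (nonzero (a ≟ 0ℚ)) eq)
  where
  nonzero : Dec (a ≡ 0ℚ) → a ≢ 0ℚ ⊎ b ≢ 0ℚ
  nonzero (yes a≡0) = inj₂ λ b≡0 → u≢0 (cong₂ _,_ a≡0 b≡0)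
  nonzero (no a≢0) = inj₁ a≢0

det-multiples : ∀ {u v w} → (∃ λ t → v ≡ t *ᵥ u) → (∃ λ t → w ≡ t *ᵥ u) → det v w ≡ 0ℚ
det-multiples {a , b} (t , refl) (t′ , refl) =
  solve 4 (λ t t′ a b → t :* a :* (t′ :* b) :- t :* b :* (t′ :* a) := con 0ℚ) refl t t′ a b

-- Parallelism passes through a nonzero vector, because both others are multiples of it.
det≡0-trans : ∀ u v w → u ≢ 0ᵥ → det u v ≡ 0ℚ → det u w ≡ 0ℚ → det v w ≡ 0ℚ
det≡0-trans u v w u≢0 uv≡0 uw≡0 = det-multiples (det≡0⇒multiple u v u≢0 uv≡0) (det≡0⇒multiple u w u≢0 uw≡0)

-- Integer combinations of plane vectors

lin : ∀ {n} → Vec ℤ n → (Fin n → ℚ²) → ℚ²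
lin [] p = 0ᵥ
lin (a ∷ u) p = fromℤ a *ᵥ p zero +ᵥ lin u (p ∘ suc)

unit : ∀ {n} → Fin n → Vec ℤ n
unit i = Vec.replicate _ 0ℤ Vec.[ i ]≔ 1ℤ

0*ᵥ+ᵥ : ∀ u v → fromℤ 0ℤ *ᵥ u +ᵥ v ≡ v
0*ᵥ+ᵥ (a , b) (c , d) = cong₂ _,_ (drop a c) (drop b d)
  where
  drop : ∀ a c → 0ℚ * a + c ≡ c
  drop = solve 2 (λ a c → con 0ℚ :* a :+ c := c) refl

lin-0 : ∀ {n} (p : Fin n → ℚ²) → lin (Vec.replicate n 0ℤ) p ≡ 0ᵥ
lin-0 {zero} p = refl
lin-0 {suc n} p = trans (0*ᵥ+ᵥ (p zero) (lin (Vec.replicate n 0ℤ) (p ∘ suc))) (lin-0 (p ∘ suc))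

lin-unit : ∀ {n} i (p : Fin n → ℚ²) → lin (unit i) p ≡ p i
lin-unit zero p = trans (cong (fromℤ 1ℤ *ᵥ p zero +ᵥ_) (lin-0 (p ∘ suc)))
  (cong₂ _,_ (identity (proj₁ (p zero))) (identity (proj₂ (p zero))))
  where
  identity : ∀ a → 1ℚ * a + 0ℚ ≡ a
  identity = solve 1 (λ a → con 1ℚ :* a :+ con 0ℚ := a) refl
lin-unit (suc i) p = trans (0*ᵥ+ᵥ (p zero) (lin (unit i) (p ∘ suc))) (lin-unit i (p ∘ suc))

lin-+ : ∀ {n} (u v : Vec ℤ n) p → lin (Vec.zipWith ℤ._+_ u v) p ≡ lin u p +ᵥ lin v p
lin-+ [] [] p = refl
lin-+ (a ∷ u) (b ∷ v) p = trans (cong (fromℤ (a ℤ.+ b) *ᵥ p zero +ᵥ_) (lin-+ u v (p ∘ suc)))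
  (cong₂ _,_ (coordinate proj₁) (coordinate proj₂))
  where
  regroup : ∀ a b x y z → (a + b) * x + (y + z) ≡ a * x + y + (b * x + z)
  regroup = solve 5 (λ a b x y z → (a :+ b) :* x :+ (y :+ z) := a :* x :+ y :+ (b :* x :+ z)) refl
  coordinate : ∀ (π : ℚ² → ℚ) →
    fromℤ (a ℤ.+ b) * π (p zero) + (π (lin u (p ∘ suc)) + π (lin v (p ∘ suc))) ≡
    fromℤ a * π (p zero) + π (lin u (p ∘ suc)) + (fromℤ b * π (p zero) + π (lin v (p ∘ suc)))
  coordinate π = trans
    (cong (λ c → c * π (p zero) + (π (lin u (p ∘ suc)) + π (lin v (p ∘ suc)))) (fromℤ-homo-+ a b))
    (regroup (fromℤ a) (fromℤ b) (π (p zero)) (π (lin u (p ∘ suc))) (π (lin v (p ∘ suc))))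

lin-- : ∀ {n} (u v : Vec ℤ n) p → lin (Vec.zipWith ℤ._-_ u v) p ≡ lin u p -ᵥ lin v p
lin-- [] [] p = refl
lin-- (a ∷ u) (b ∷ v) p = trans (cong (fromℤ (a ℤ.- b) *ᵥ p zero +ᵥ_) (lin-- u v (p ∘ suc)))
  (cong₂ _,_ (coordinate proj₁) (coordinate proj₂))
  where
  regroup : ∀ a b x y z → (a - b) * x + (y - z) ≡ a * x + y - (b * x + z)
  regroup = solve 5 (λ a b x y z → (a :- b) :* x :+ (y :- z) := a :* x :+ y :- (b :* x :+ z)) refl
  coordinate : ∀ (π : ℚ² → ℚ) →
    fromℤ (a ℤ.- b) * π (p zero) + (π (lin u (p ∘ suc)) - π (lin v (p ∘ suc))) ≡
    fromℤ a * π (p zero) + π (lin u (p ∘ suc)) - (fromℤ b * π (p zero) + π (lin v (p ∘ suc)))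
  coordinate π = trans
    (cong (λ c → c * π (p zero) + (π (lin u (p ∘ suc)) - π (lin v (p ∘ suc)))) (fromℤ-homo-- a b))
    (regroup (fromℤ a) (fromℤ b) (π (p zero)) (π (lin u (p ∘ suc))) (π (lin v (p ∘ suc))))

-- Plücker coordinates

wedge : Vec ℤ 4 → Vec ℤ 4 → ℤ⁶
wedge (a ∷ b ∷ c ∷ d ∷ []) (a′ ∷ b′ ∷ c′ ∷ d′ ∷ []) =
  (a ℤ.* b′ ℤ.- b ℤ.* a′) ∷ (a ℤ.* c′ ℤ.- c ℤ.* a′) ∷ (a ℤ.* d′ ℤ.- d ℤ.* a′) ∷
  (b ℤ.* c′ ℤ.- c ℤ.* b′) ∷ (b ℤ.* d′ ℤ.- d ℤ.* b′) ∷ (c ℤ.* d′ ℤ.- d ℤ.* c′) ∷ []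

plücker : (Fin 4 → ℚ²) → ℚ⁶
plücker p = det (p 0F) (p 1F) ∷ det (p 0F) (p 2F) ∷ det (p 0F) (p 3F) ∷
            det (p 1F) (p 2F) ∷ det (p 1F) (p 3F) ∷ det (p 2F) (p 3F) ∷ []

plücker≡𝟎 : ∀ {p} → (∀ i j → det (p i) (p j) ≡ 0ℚ) → plücker p ≡ 𝟎
plücker≡𝟎 h = cong₂ _∷_ (h 0F 1F) (cong₂ _∷_ (h 0F 2F) (cong₂ _∷_ (h 0F 3F)
  (cong₂ _∷_ (h 1F 2F) (cong₂ _∷_ (h 1F 3F) (cong₂ _∷_ (h 2F 3F) refl)))))

plücker-relation : ∀ p → quadricℚ (plücker p) ≡ 0ℚ
plücker-relation p = relation (proj₁ (p 0F)) (proj₂ (p 0F)) (proj₁ (p 1F)) (proj₂ (p 1F))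
                              (proj₁ (p 2F)) (proj₂ (p 2F)) (proj₁ (p 3F)) (proj₂ (p 3F))
  where
  relation : ∀ a b c d e f g h →
    (a * d - b * c) * (e * h - f * g) - (a * f - b * e) * (c * h - d * g) + (a * h - b * g) * (c * f - d * e) ≡ 0ℚ
  relation = solve 8 (λ a b c d e f g h →
    (a :* d :- b :* c) :* (e :* h :- f :* g) :- (a :* f :- b :* e) :* (c :* h :- d :* g) :+
    (a :* h :- b :* g) :* (c :* f :- d :* e) := con 0ℚ) refl

-- The Cauchy-Binet formula. It turns parallelism of two integer combinations into an integer linear
-- condition on `plücker p`.
det-lin : ∀ u v p → det (lin u p) (lin v p) ≡ wedge u v ∙ plücker p
det-lin (a ∷ b ∷ c ∷ d ∷ []) (a′ ∷ b′ ∷ c′ ∷ d′ ∷ []) p = trans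
  (cauchy-binet (fromℤ a) (fromℤ b) (fromℤ c) (fromℤ d) (fromℤ a′) (fromℤ b′) (fromℤ c′) (fromℤ d′)
    (proj₁ (p 0F)) (proj₂ (p 0F)) (proj₁ (p 1F)) (proj₂ (p 1F))
    (proj₁ (p 2F)) (proj₂ (p 2F)) (proj₁ (p 3F)) (proj₂ (p 3F)))
  (sym (cong₂ _+_ (minor a b′ b a′) (cong₂ _+_ (minor a c′ c a′) (cong₂ _+_ (minor a d′ d a′)
    (cong₂ _+_ (minor b c′ c b′) (cong₂ _+_ (minor b d′ d b′) (cong₂ _+_ (minor c d′ d c′) refl)))))))
  where
  minor : ∀ a b′ b a′ {q} → fromℤ (a ℤ.* b′ ℤ.- b ℤ.* a′) * q ≡ (fromℤ a * fromℤ b′ - fromℤ b * fromℤ a′) * q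
  minor a b′ b a′ {q} = cong (_* q) (fromℤ-minor a b′ b a′)
  cauchy-binet : ∀ a b c d a′ b′ c′ d′ x₁ y₁ x₂ y₂ x₃ y₃ x₄ y₄ →
    (a * x₁ + (b * x₂ + (c * x₃ + (d * x₄ + 0ℚ)))) * (a′ * y₁ + (b′ * y₂ + (c′ * y₃ + (d′ * y₄ + 0ℚ)))) -
    (a * y₁ + (b * y₂ + (c * y₃ + (d * y₄ + 0ℚ)))) * (a′ * x₁ + (b′ * x₂ + (c′ * x₃ + (d′ * x₄ + 0ℚ)))) ≡
    (a * b′ - b * a′) * (x₁ * y₂ - y₁ * x₂) + ((a * c′ - c * a′) * (x₁ * y₃ - y₁ * x₃) +
    ((a * d′ - d * a′) * (x₁ * y₄ - y₁ * x₄) + ((b * c′ - c * b′) * (x₂ * y₃ - y₂ * x₃) +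
    ((b * d′ - d * b′) * (x₂ * y₄ - y₂ * x₄) + ((c * d′ - d * c′) * (x₃ * y₄ - y₃ * x₄) + 0ℚ)))))
  cauchy-binet = solve 16 (λ a b c d a′ b′ c′ d′ x₁ y₁ x₂ y₂ x₃ y₃ x₄ y₄ →
    (a :* x₁ :+ (b :* x₂ :+ (c :* x₃ :+ (d :* x₄ :+ con 0ℚ)))) :*
    (a′ :* y₁ :+ (b′ :* y₂ :+ (c′ :* y₃ :+ (d′ :* y₄ :+ con 0ℚ)))) :-
    (a :* y₁ :+ (b :* y₂ :+ (c :* y₃ :+ (d :* y₄ :+ con 0ℚ)))) :*
    (a′ :* x₁ :+ (b′ :* x₂ :+ (c′ :* x₃ :+ (d′ :* x₄ :+ con 0ℚ)))) :=
    (a :* b′ :- b :* a′) :* (x₁ :* y₂ :- y₁ :* x₂) :+ ((a :* c′ :- c :* a′) :* (x₁ :* y₃ :- y₁ :* x₃) :+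
    ((a :* d′ :- d :* a′) :* (x₁ :* y₄ :- y₁ :* x₄) :+ ((b :* c′ :- c :* b′) :* (x₂ :* y₃ :- y₂ :* x₃) :+
    ((b :* d′ :- d :* b′) :* (x₂ :* y₄ :- y₂ :* x₄) :+ ((c :* d′ :- d :* c′) :* (x₃ :* y₄ :- y₃ :* x₄) :+
    con 0ℚ)))))) refl

-- The entries of S

-- Symbolic entries, independent of `p`, so that a single search serves all `p`. The coordinates of
-- the 16 members of `roots` are the positive roots of type B₄.
data Root : Set where
  ⟨_⟩ : Fin 4 → Root
  _⊕_ _⊖_ : Fin 4 → Fin 4 → Root

value : (Fin 4 → ℚ²) → Root → ℚ²
value p ⟨ i ⟩ = p i
value p (i ⊕ j) = p i +ᵥ p j
value p (i ⊖ j) = p i -ᵥ p j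

coords : Root → Vec ℤ 4
coords ⟨ i ⟩ = unit i
coords (i ⊕ j) = Vec.zipWith ℤ._+_ (unit i) (unit j)
coords (i ⊖ j) = Vec.zipWith ℤ._-_ (unit i) (unit j)

Distinct : Root → Set
Distinct ⟨ _ ⟩ = ⊤
Distinct (i ⊕ j) = i ≢ j
Distinct (i ⊖ j) = i ≢ j

distinct? : ∀ r → Dec (Distinct r)
distinct? ⟨ _ ⟩ = yes _
distinct? (i ⊕ j) = ¬? (i Fin.≟ j)
distinct? (i ⊖ j) = ¬? (i Fin.≟ j)

roots : List Root
roots = map ⟨_⟩ (allFin 4) ++ map (uncurry _⊕_) (pairs 4) ++ map (uncurry _⊖_) (pairs 4)

roots-distinct : All Distinct roots
roots-distinct = toWitness {a? = All.all? distinct? roots} _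

-- The positions are compared through `toℕ` because their types mention different lengths.
lookup-map : ∀ {A B : Set} (f : A → B) xs (k : Fin (length (map f xs))) (l : Fin (length xs)) →
             toℕ k ≡ toℕ l → lookup (map f xs) k ≡ f (lookup xs l)
lookup-map f (x ∷ xs) zero zero _ = refl
lookup-map f (x ∷ xs) (suc k) (suc l) eq = lookup-map f xs k l (ℕ.suc-injective eq)

lookup-S : ∀ p k → lookup (S p) k ≡ value p (lookup roots k)
-- `S p` and `map (value p) roots` compute to the same list, and the lengths compute to 16, so `k`
-- is a position in both lists.
lookup-S p k = lookup-map (value p) roots k k refl

lin-coords : ∀ p r → lin (coords r) p ≡ value p r
lin-coords p ⟨ i ⟩ = lin-unit i p
lin-coords p (i ⊕ j) = trans (lin-+ (unit i) (unit j) p) (cong₂ _+ᵥ_ (lin-unit i p) (lin-unit j p))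
lin-coords p (i ⊖ j) = trans (lin-- (unit i) (unit j) p) (cong₂ _-ᵥ_ (lin-unit i p) (lin-unit j p))

det-value : ∀ p r r′ → det (value p r) (value p r′) ≡ wedge (coords r) (coords r′) ∙ plücker p
det-value p r r′ = trans (sym (cong₂ det (lin-coords p r) (lin-coords p r′))) (det-lin (coords r) (coords r′) p)

form : Fin 16 → Fin 16 → ℤ⁶
form k l = wedge (coords (lookup roots k)) (coords (lookup roots l))

_≈±_ : ℤ⁶ → ℤ⁶ → Set
v ≈± w = w ≡ v ⊎ w ≡ Vec.map ℤ.-_ v

_≈±?_ : ∀ v w → Dec (v ≈± w)
v ≈±? w = Vec.≡-dec ℤ._≟_ w v ⊎-dec Vec.≡-dec ℤ._≟_ w (Vec.map ℤ.-_ v)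

≈±-resp : ∀ {d v w} → v ≈± w → w ∙ d ≡ 0ℚ → v ∙ d ≡ 0ℚ
≈±-resp (inj₁ refl) eq = eq
≈±-resp {d} {v} (inj₂ refl) eq = neg-injective (trans (sym (∙-neg v d)) eq)

-- Forms that differ by a sign have the same zeros. Keeping one of each pair reduces the branching
-- of the search.
partners : Fin 16 → List ℤ⁶
partners k = deduplicate _≈±?_ (map (form k) (filter (λ l → ¬? (l Fin.≟ k)) (allFin 16)))

-- At `plücker p` these forms give the determinants of the entry with all four vectors `p i`.
degeneracies : Root → List ℤ⁶
degeneracies r = map (λ i → wedge (coords r) (unit i)) (allFin 4)

-- The finite case analysis, done by evaluation and started from the whole of ℚ⁶.
search : refutes (map degeneracies roots) (map partners (allFin 16)) (units 6) ≡ true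
search = refl

-- Four vectors without a lonely entry

module _ (p : Fin 4 → ℚ²) (p≢0 : ∀ i → p i ≢ 0ᵥ)
         (p≢±p : ∀ i j → i ≢ j → (p i ≢ p j) × (p i ≢ -ᵥ p j)) where

  value≢0 : ∀ r → Distinct r → value p r ≢ 0ᵥ
  value≢0 ⟨ i ⟩ _ eq = p≢0 i eq
  value≢0 (i ⊕ j) i≢j eq = proj₂ (p≢±p i j i≢j) (cong₂ _,_
    (inverseˡ-unique +-0-group _ _ (cong proj₁ eq)) (inverseˡ-unique +-0-group _ _ (cong proj₂ eq)))
  value≢0 (i ⊖ j) i≢j eq = proj₁ (p≢±p i j i≢j) (cong₂ _,_
    (x∙y⁻¹≈ε⇒x≈y +-0-group _ _ (cong proj₁ eq)) (x∙y⁻¹≈ε⇒x≈y +-0-group _ _ (cong proj₂ eq)))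

  -- Every `p i` is parallel to the entry, which is nonzero, so the `p i` are parallel to each
  -- other.
  degenerate⇒plücker≡𝟎 : ∀ {r} → Distinct r → All (λ w → w ∙ plücker p ≡ 0ℚ) (degeneracies r) → plücker p ≡ 𝟎
  degenerate⇒plücker≡𝟎 {r} dr vs =
    plücker≡𝟎 {p} λ i j → det≡0-trans (value p r) (p i) (p j) (value≢0 r dr) (flat i) (flat j)
    where
    flat : ∀ i → det (value p r) (p i) ≡ 0ℚ
    flat i = trans (det-value p r ⟨ i ⟩)
      (All.lookup (All.map⁻ {f = λ i → wedge (coords r) (unit i)} vs) (∈-allFin i))

  admissible : Admissible (map degeneracies roots) (plücker p)
  admissible = plücker-relation p , All.map⁺ (All.map (λ {r} → degenerate⇒plücker≡𝟎 {r}) roots-distinct)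

  -- Stated with determinants rather than `Parallel`, since equality in ℚ is decidable. This makes
  -- `Lonely` decidable, as the proof by contradiction requires.
  Unparallel : Fin 16 → Fin 16 → Set
  Unparallel k l = l ≢ k → det (lookup (S p) k) (lookup (S p) l) ≢ 0ℚ

  unparallel? : ∀ k l → Dec (Unparallel k l)
  unparallel? k l = ¬? (l Fin.≟ k) →-dec ¬? (det (lookup (S p) k) (lookup (S p) l) ≟ 0ℚ)

  Lonely : Set
  Lonely = ∃ λ k → ∀ l → Unparallel k l

  lonely? : Dec Lonely
  lonely? = Fin.any? λ k → Fin.all? (unparallel? k)

  ¬unparallel⇒partner : ∀ k l → ¬ Unparallel k l → Any (λ w → w ∙ plücker p ≡ 0ℚ) (partners k)
  ¬unparallel⇒partner k l h =
    Any.deduplicate⁺ _≈±?_ ≈±-resp (Any.map⁺ (lose (∈-filter⁺ (λ l → ¬? (l Fin.≟ k)) (∈-allFin l) l≢k) form≡0))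
    where
    l≢k : l ≢ k
    -- For `l ≡ k` the condition `Unparallel k l` would hold vacuously.
    l≢k l≡k = h λ l≢k _ → l≢k l≡k
    det≡0 : det (lookup (S p) k) (lookup (S p) l) ≡ 0ℚ
    det≡0 = decidable-stable (det (lookup (S p) k) (lookup (S p) l) ≟ 0ℚ) λ det≢0 → h λ _ → det≢0
    form≡0 : form k l ∙ plücker p ≡ 0ℚ
    form≡0 = trans (sym (det-value p (lookup roots k) (lookup roots l)))
      (trans (sym (cong₂ det (lookup-S p k) (lookup-S p l))) det≡0)

  ¬lonely⇒partner : ¬ Lonely → ∀ k → Any (λ w → w ∙ plücker p ≡ 0ℚ) (partners k)
  ¬lonely⇒partner ¬lonely k = uncurry (¬unparallel⇒partner k)
    (Fin.¬∀⟶∃¬ 16 (Unparallel k) (unparallel? k) λ h → ¬lonely (k , h))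

  ¬lonely⇒plücker≡𝟎 : ¬ Lonely → plücker p ≡ 𝟎
  ¬lonely⇒plücker≡𝟎 ¬lonely = refutes-sound admissible (map partners (allFin 16)) (units 6) search
    (All.map⁺ (All.universal (¬lonely⇒partner ¬lonely) (allFin 16))) (Span-units (plücker p))

  ¬lonely⇒parallel : ¬ Lonely → ∀ i j → Parallel (p i) (p j)
  ¬lonely⇒parallel ¬lonely i j = inj₂ (det≡0⇒multiple (p i) (p j) (p≢0 i) (begin
    det (p i) (p j)                     ≡⟨ det-value p ⟨ i ⟩ ⟨ j ⟩ ⟩
    wedge (unit i) (unit j) ∙ plücker p ≡⟨ cong (wedge (unit i) (unit j) ∙_) (¬lonely⇒plücker≡𝟎 ¬lonely) ⟩
    wedge (unit i) (unit j) ∙ 𝟎         ≡⟨ ∙-𝟎 (wedge (unit i) (unit j)) ⟩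
    0ℚ                                  ∎))

proposition4p4 : (p : Fin 4 → ℚ²) →
    (∀ i → p i ≢ 0ᵥ) →
    ¬ (∀ i j → Parallel (p i) (p j)) →
    (∀ i j → i ≢ j → (p i ≢ p j) × (p i ≢ -ᵥ p j)) →
    LonelyVectorProperty p
proposition4p4 p p≢0 ¬parallel p≢±p =
  -- `Lonely` is decidable, so it suffices to refute its negation, which would make all the `p i`
  -- parallel. Nonzero determinants then exclude `Parallel`.
  map₂ (λ h l l≢k → h l l≢k ∘ Parallel⇒det≡0)
    (decidable-stable (lonely? p p≢0 p≢±p) (¬parallel ∘ ¬lonely⇒parallel p p≢0 p≢±p))
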